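{- A $\neg\neg$-sheaf is $0$-truncated (a set) if and only if it is $\neg\neg$-separated. Consequently $\nabla_0$ reflects onto exactly the $\neg\neg$-sheaves that are $0$-truncated.
   Context: Setting: homotopy type theory with a univalent universe $\mathcal{U}$ of small types and higher inductive types. It is assumed that there is a small type $\Omega_{\neg\neg}:\mathcal{U}$ with a map $|\cdot|:\Omega_{\neg\neg}\to\mathcal{U}$ such that each $|z|$ is a $\neg\neg$-stable proposition and every $\neg\neg$-stable proposition is $|z|$ for a unique $z$; we identify $z$ with $|z|$. A type $X$ is $\neg\neg$-separated if $\neg\neg(x=y)\to x=y$ for all $x,y:X$. A proposition $P$ is $\neg\neg$-dense if $\neg\neg P$. A type $X$ is a $\neg\neg$-sheaf if for every $\neg\neg$-dense proposition $P$ the constant-function map $X\to X^P$ is an equivalence. For a type $X$, $\nabla_0X$ is the type of $\xi:X\to\Omega_{\neg\neg}$ such that $\neg\neg\sum_{x:X}\xi(x)$ and $\prod_{x,y:X}\xi(x)\to\xi(y)\to\neg\neg(x=y)$, with unit $\iota_X:X\to\nabla_0X$, $x\mapsto\lambda y.\neg\neg(x=y)$; $\nabla_0$ is a higher modality whose modal types are the $\neg\neg$-separated $\neg\neg$-sheaves. -}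

{-# OPTIONS --without-K #-}
module Defs where

open import Level using (Level; _⊔_)
open import Data.Product using (Σ; Σ-syntax; _×_; _,_; proj₁; proj₂)
open import Function.Base using (_∘_; id; const)
open import Function.Bundles using (_⇔_)
open import Relation.Binary.PropositionalEquality using (_≡_; refl; sym; subst)
open import Relation.Nullary using (¬_; Irrelevant)
open import Relation.Nullary.Negation using (Stable; negated-stable)
open import Axiom.UniquenessOfIdentityProofs using (UIP)

-- The universe 𝒰 of small types is Set.  The n-types below level 1 are the
-- library's: Irrelevant P is "P is a proposition" and UIP X is "X is a set".

private
  variable
    a b : Level

IsContr : Set a → Set a
IsContr A = Σ[ c ∈ A ] ((x : A) → c ≡ x)

Fibre : {A : Set a} {B : Set b} → (A → B) → B → Set (a ⊔ b)
Fibre {A = A} f y = Σ[ x ∈ A ] f x ≡ y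

IsEquiv : {A : Set a} {B : Set b} → (A → B) → Set (a ⊔ b)
IsEquiv {B = B} f = (y : B) → IsContr (Fibre f y)

infix 4 _≃_
_≃_ : Set a → Set b → Set (a ⊔ b)
A ≃ B = Σ (A → B) IsEquiv

id-isEquiv : {A : Set a} → IsEquiv (id {A = A})
id-isEquiv y = (y , refl) , λ { (_ , refl) → refl }

idToEquiv : {A B : Set a} → A ≡ B → A ≃ B
idToEquiv refl = id , id-isEquiv

Univalence : Set₁
Univalence = (A B : Set) → IsEquiv (idToEquiv {A = A} {B = B})

IsSeparated : Set → Set
IsSeparated X = (x y : X) → Stable (x ≡ y)

IsSheaf : Set → Set₁
IsSheaf X = (P : Set) → Irrelevant P → ¬ ¬ P → IsEquiv (λ (x : X) → const {B = P} x)

-- A small type Ω of codes for the ¬¬-stable propositions of Set.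
record StableClassifier : Set₁ where
  field
    Ω             : Set
    ∣_∣           : Ω → Set
    ∣∣-irrelevant : (z : Ω) → Irrelevant ∣ z ∣
    ∣∣-stable     : (z : Ω) → Stable ∣ z ∣
    classify      : (P : Set) → Irrelevant P → Stable P →
                    IsContr (Σ[ z ∈ Ω ] ∣ z ∣ ≡ P)

module _ (S : StableClassifier) where
  open StableClassifier S

  ∇₀ : Set → Set
  ∇₀ X = Σ[ ξ ∈ (X → Ω) ]
           (¬ ¬ (Σ[ x ∈ X ] ∣ ξ x ∣)) ×
           ((x y : X) → ∣ ξ x ∣ → ∣ ξ y ∣ → ¬ ¬ (x ≡ y))

  -- Elements of the library's ⊥ are definitionally equal, so negations are
  -- propositions by refl, without function extensionality.
  ¬¬-code : (A : Set) → Σ[ z ∈ Ω ] ∣ z ∣ ≡ (¬ ¬ A)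
  ¬¬-code A = proj₁ (classify (¬ ¬ A) (λ _ _ → refl) negated-stable)

  ι : (X : Set) → X → ∇₀ X
  ι X x = (λ y → proj₁ (code y)) , inhabited , unique
    where
    code : (y : X) → Σ[ z ∈ Ω ] ∣ z ∣ ≡ (¬ ¬ (x ≡ y))
    code y = ¬¬-code (x ≡ y)

    decode : (y : X) → ∣ proj₁ (code y) ∣ → ¬ ¬ (x ≡ y)
    decode y = subst id (proj₂ (code y))

    inhabited : ¬ ¬ (Σ[ y ∈ X ] ∣ proj₁ (code y) ∣)
    inhabited k = k (x , subst id (sym (proj₂ (code x))) (λ n → n refl))

    unique : (y z : X) → ∣ proj₁ (code y) ∣ → ∣ proj₁ (code z) ∣ → ¬ ¬ (y ≡ z)
    unique y z p q n =
      decode y p λ { refl → decode z q n }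

-- (○ , η) is a reflection of Set onto the subuniverse M, and the types it
-- leaves unchanged are exactly those in M.
record ReflectsOntoExactly (M : Set → Set₁) (○ : Set → Set)
                           (η : (X : Set) → X → ○ X) : Set₁ where
  field
    reflected : (X : Set) → M (○ X)
    universal : (X Y : Set) → M Y → IsEquiv (λ (g : ○ X → Y) → g ∘ η X)
    exactly   : (X : Set) → IsEquiv (η X) ⇔ M X

{-# OPTIONS --without-K #-}
-- For a sheaf that is a set, x ≡ y is a proposition; when it is dense, const x
-- and const y agree as maps out of it, so x ≡ y.  The converse is Hedberg's
-- theorem.  Among sheaves, "set" and "separated" can thus be interchanged, and
-- in separated types it suffices to prove equations up to ¬¬, which is how every
-- point of ∇₀ X may be taken to be of the form ι x.  Maps ∇₀ X → Y into
-- a separated sheaf are built by gluing over a dense proposition of possible values.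
module Submission where

open import Defs
open import Data.Product using (Σ-syntax; _×_; _,_; proj₁; proj₂)
open import Function.Base using (_∘_; id; const)
open import Function.Bundles using (_⇔_; mk⇔)
open import Relation.Binary.PropositionalEquality
  using (_≡_; refl; sym; trans; cong; cong-app; subst)
open import Relation.Nullary using (¬_; Irrelevant)
open import Axiom.UniquenessOfIdentityProofs using (UIP; module Constant⇒UIP)

-- The stability map is constant because ¬¬ (x ≡ y) has definitionally equal elements.
separated⇒UIP : {X : Set} → IsSeparated X → UIP X
separated⇒UIP sep =
  Constant⇒UIP.≡-irrelevant (λ {x} {y} p → sep x y (λ k → k p)) (λ _ _ → refl)

irrelevant⇒separated : {P : Set} → Irrelevant P → IsSeparated P
irrelevant⇒separated irr x y _ = irr x y

-- As `B` is a set, points of a fibre agree once their first components do, and injectivity gives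
-- that.
isEquiv-intoSeparated : {A B : Set} → IsSeparated B → (f : A → B) →
  ({x y : A} → f x ≡ f y → x ≡ y) → ((y : B) → Fibre f y) → IsEquiv f
isEquiv-intoSeparated {A} sep f injective section y =
  section y , λ { (x , e) → fibre-≡ (injective (trans (proj₂ (section y)) (sym e))) }
  where
  fibre-≡ : {x x′ : A} {e : f x ≡ y} {e′ : f x′ ≡ y} → x ≡ x′ → (x , e) ≡ (x′ , e′)
  fibre-≡ refl = cong (_ ,_) (separated⇒UIP sep _ _)

module _ (univalence : Univalence) where

  ua : {A B : Set} → A ≃ B → A ≡ B
  ua e = proj₁ (proj₁ (univalence _ _ e))

  idToEquiv-ua : {A B : Set} (e : A ≃ B) → idToEquiv (ua e) ≡ e
  idToEquiv-ua e = proj₂ (proj₁ (univalence _ _ e))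

  -- By univalence `e` is `idToEquiv` of a path, which path induction turns into the identity.
  equiv-epi : {A B C : Set} (e : A ≃ B) (g h : B → C) →
    g ∘ proj₁ e ≡ h ∘ proj₁ e → g ≡ h
  equiv-epi e g h = subst (λ e′ → g ∘ proj₁ e′ ≡ h ∘ proj₁ e′ → g ≡ h)
                          (idToEquiv-ua e) (epi (ua e) g h)
    where
    epi : {A B C : Set} (p : A ≡ B) (g h : B → C) →
      g ∘ proj₁ (idToEquiv p) ≡ h ∘ proj₁ (idToEquiv p) → g ≡ h
    epi refl g h eq = eq

  -- The diagonal of B is an equivalence onto the path space of B, so the two
  -- endpoint projections, which agree on the diagonal, are equal.
  funext : {A B : Set} {f g : A → B} → ((x : A) → f x ≡ g x) → f ≡ g
  funext {A} {B} {f} {g} f~g =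
    cong (_∘ (λ x → f x , g x , f~g x)) (equiv-epi (diagonal , diagonal-isEquiv) source target refl)
    where
    Path : Set
    Path = Σ[ x ∈ B ] Σ[ y ∈ B ] x ≡ y

    source target : Path → B
    source = proj₁
    target = proj₁ ∘ proj₂

    diagonal : B → Path
    diagonal x = x , x , refl

    diagonal-isEquiv : IsEquiv diagonal
    diagonal-isEquiv (x , _ , refl) = (x , refl) , λ { (_ , refl) → refl }

  propext : {P Q : Set} → Irrelevant P → Irrelevant Q → (P → Q) → (Q → P) → P ≡ Q
  propext irrP irrQ f g =
    ua (f , isEquiv-intoSeparated (irrelevant⇒separated irrQ) f
              (λ _ → irrP _ _) (λ q → g q , irrQ _ q))

  →-separated : {A B : Set} → IsSeparated B → IsSeparated (A → B)
  →-separated sep f g ¬¬f≡g =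
    funext λ x → sep (f x) (g x) λ k → ¬¬f≡g λ f≡g → k (cong-app f≡g x)

  sheaf∧UIP⇒separated : {X : Set} → IsSheaf X → UIP X → IsSeparated X
  sheaf∧UIP⇒separated {X} sheaf uip x y dense =
    trans (sym (cong proj₁ (contract (x , refl))))
          -- Each `p : x ≡ y` is itself the proof that `const x` and `const y` agree at `p`, so `y`
          -- lies in the fibre over `const x`.
          (cong proj₁ (contract (y , sym (funext id))))
    where
    contract : (c : Fibre (λ (z : X) → const {B = x ≡ y} z) (const x)) → _ ≡ c
    contract = proj₂ (sheaf (x ≡ y) uip dense (const x))

  module _ (S : StableClassifier) where
    open StableClassifier S

    -- Both codes lie in the contractible type of codes for `∣ w ∣`.
    ∣∣-injective : {z w : Ω} → ∣ z ∣ ≡ ∣ w ∣ → z ≡ w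
    ∣∣-injective {z} {w} p = trans (sym (cong proj₁ (contract (z , p))))
                                   (cong proj₁ (contract (w , refl)))
      where contract = proj₂ (classify ∣ w ∣ (∣∣-irrelevant w) (∣∣-stable w))

    Ω-ext : {z w : Ω} → (∣ z ∣ → ∣ w ∣) → (∣ w ∣ → ∣ z ∣) → z ≡ w
    Ω-ext f g = ∣∣-injective (propext (∣∣-irrelevant _) (∣∣-irrelevant _) f g)

    Ω-separated : IsSeparated Ω
    Ω-separated z w ¬¬z≡w = Ω-ext
      (λ p → ∣∣-stable w λ k → ¬¬z≡w λ { refl → k p })
      (λ q → ∣∣-stable z λ k → ¬¬z≡w λ { refl → k q })

    ⌜¬¬_⌝ : Set → Ω
    ⌜¬¬ A ⌝ = proj₁ (¬¬-code S A)

    encode : {A : Set} → ¬ ¬ A → ∣ ⌜¬¬ A ⌝ ∣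
    encode {A} = subst id (sym (proj₂ (¬¬-code S A)))

    decode : {A : Set} → ∣ ⌜¬¬ A ⌝ ∣ → ¬ ¬ A
    decode {A} = subst id (proj₂ (¬¬-code S A))

    -- The remaining components are negations, hence definitionally irrelevant.
    ∇₀-≡ : {X : Set} {ξ ζ : ∇₀ S X} → proj₁ ξ ≡ proj₁ ζ → ξ ≡ ζ
    ∇₀-≡ refl = refl

    ∇₀-separated : (X : Set) → IsSeparated (∇₀ S X)
    ∇₀-separated X ξ ζ ¬¬ξ≡ζ =
      ∇₀-≡ (→-separated Ω-separated _ _ λ k → ¬¬ξ≡ζ λ ξ≡ζ → k (cong proj₁ ξ≡ζ))

    ∇₀-sheaf : (X : Set) → IsSheaf (∇₀ S X)
    ∇₀-sheaf X P irr dense =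
      isEquiv-intoSeparated (→-separated (∇₀-separated X)) const const-injective
        λ f → glue f , funext (glue-≡ f)
      where
      const-injective : {ξ ζ : ∇₀ S X} → const {B = P} ξ ≡ const ζ → ξ ≡ ζ
      const-injective e = ∇₀-separated X _ _ λ k → dense λ p → k (cong-app e p)

      module _ (f : P → ∇₀ S X) where
        glue : ∇₀ S X
        -- At `x`, some `f p` holds; the double negation makes this stable, so that it has a code in
        -- `Ω`.
        glue = (λ x → ⌜¬¬ Σ[ p ∈ P ] ∣ proj₁ (f p) x ∣ ⌝)
             , (λ k → dense λ p → proj₁ (proj₂ (f p)) λ { (x , m) →
                  k (x , encode λ n → n (p , m)) })
             , λ x y mx my k → decode mx λ { (p , m) → decode my λ { (q , n) →
                  proj₂ (proj₂ (f p)) x y m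
                    (subst (λ r → ∣ proj₁ (f r) y ∣) (irr q p) n) k } }

        glue-≡ : (p : P) → glue ≡ f p
        glue-≡ p = ∇₀-≡ (funext λ x → Ω-ext
          (λ m → ∣∣-stable (proj₁ (f p) x) λ k → decode m λ { (q , n) →
             k (subst (λ r → ∣ proj₁ (f r) x ∣) (irr q p) n) })
          (λ m → encode λ k → k (p , m)))

    -- Members of `ξ` are ¬¬-equal and membership is stable, so a single member `x` determines `ξ`.
    ι-≡ : {X : Set} (ξ : ∇₀ S X) (x : X) → ∣ proj₁ ξ x ∣ → ι S X x ≡ ξ
    ι-≡ (ξ , _ , unique) x m = ∇₀-≡ (funext λ y → Ω-ext
      (λ n → ∣∣-stable (ξ y) λ k → decode n λ { refl → k m })
      (λ n → encode (unique x y m n)))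

    ¬¬ι-surjective : {X : Set} (ξ : ∇₀ S X) → ¬ ¬ Fibre (ι S X) ξ
    ¬¬ι-surjective ξ k = proj₁ (proj₂ ξ) λ { (x , m) → k (x , ι-≡ ξ x m) }

    ι-injective : {X : Set} → IsSeparated X → {x y : X} → ι S X x ≡ ι S X y → x ≡ y
    ι-injective sep {x} {y} e =
      -- Reflexivity puts `y` in `ι S X y`; carried back along `e`, this becomes membership of `y`
      -- in `ι S X x`, which decodes to `¬ ¬ (x ≡ y)`.
      sep x y (decode (subst (λ ξ → ∣ proj₁ ξ y ∣) (sym e) (encode λ k → k refl)))

    ∘ι-isEquiv : {X Y : Set} → IsSheaf Y → IsSeparated Y →
      IsEquiv (λ (g : ∇₀ S X → Y) → g ∘ ι S X)
    ∘ι-isEquiv {X} {Y} sheaf sep =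
      isEquiv-intoSeparated (→-separated sep) (_∘ ι S X) ∘ι-injective
        λ f → extend f , funext (extend-ι f)
      where
      ∘ι-injective : {g h : ∇₀ S X → Y} → g ∘ ι S X ≡ h ∘ ι S X → g ≡ h
      ∘ι-injective {g} {h} e = funext λ ξ → sep (g ξ) (h ξ) λ k →
        ¬¬ι-surjective ξ λ { (x , refl) → k (cong-app e x) }

      module _ (f : X → Y) where
        -- The candidates for the extension at `ξ`. Under the double negation a candidate is fixed
        -- by its first component, which separation of `Y` makes unique.
        Value : ∇₀ S X → Set
        Value ξ = Σ[ y ∈ Y ] ¬ ¬ (Σ[ x ∈ X ] ∣ proj₁ ξ x ∣ × f x ≡ y)

        Value-≡ : {ξ : ∇₀ S X} {u v : Value ξ} → proj₁ u ≡ proj₁ v → u ≡ v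
        Value-≡ refl = refl

        Value-irrelevant : (ξ : ∇₀ S X) → Irrelevant (Value ξ)
        Value-irrelevant ξ (y , u) (z , v) = Value-≡ {ξ} (sep y z λ k →
          u λ { (x , m , refl) → v λ { (x′ , n , refl) →
            proj₂ (proj₂ ξ) x x′ m n λ x≡x′ → k (cong f x≡x′) } })

        Value-dense : (ξ : ∇₀ S X) → ¬ ¬ Value ξ
        Value-dense ξ k = proj₁ (proj₂ ξ) λ { (x , m) →
          k (f x , λ n → n (x , m , refl)) }

        glued : (ξ : ∇₀ S X) → Fibre const proj₁
        glued ξ = proj₁ (sheaf (Value ξ) (Value-irrelevant ξ) (Value-dense ξ) proj₁)

        extend : ∇₀ S X → Y
        extend = proj₁ ∘ glued

        extend-ι : (x : X) → extend (ι S X x) ≡ f x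
        -- The glued point equals every candidate, and `f x` is one at `ι S X x`, with `x` itself as
        -- member.
        extend-ι x = cong-app (proj₂ (glued (ι S X x)))
          (f x , λ n → n (x , encode (λ k → k refl) , refl))

    ι-isEquiv : {X : Set} → IsSheaf X → IsSeparated X → IsEquiv (ι S X)
    ι-isEquiv {X} sheaf sep =
      isEquiv-intoSeparated (∇₀-separated X) (ι S X) (ι-injective sep) preimage
      where
      preimage : (ξ : ∇₀ S X) → Fibre (ι S X) ξ
      -- The equation lives in a separated type, so a member `x` may be assumed; the glued point
      -- then equals `x`.
      preimage ξ = proj₁ glued , ∇₀-separated X _ ξ λ k →
        proj₁ (proj₂ ξ) λ { (x , m) →
          k (trans (cong (ι S X) (cong-app (proj₂ glued) (x , m))) (ι-≡ ξ x m)) }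
        where
        Member : Set
        Member = Σ[ x ∈ X ] ∣ proj₁ ξ x ∣

        Member-≡ : {u v : Member} → proj₁ u ≡ proj₁ v → u ≡ v
        Member-≡ refl = cong (_ ,_) (∣∣-irrelevant _ _ _)

        -- Separation of `X` makes the member of `ξ` strictly unique, so the sheaf condition applies
        -- to `Member`.
        Member-irrelevant : Irrelevant Member
        Member-irrelevant (x , m) (y , n) =
          Member-≡ (sep x y (proj₂ (proj₂ ξ) x y m n))

        glued : Fibre const proj₁
        glued = proj₁ (sheaf Member Member-irrelevant (proj₁ (proj₂ ξ)) proj₁)

    ∇₀-sheaf∧UIP : (X : Set) → IsSheaf (∇₀ S X) × UIP (∇₀ S X)
    ∇₀-sheaf∧UIP X = ∇₀-sheaf X , separated⇒UIP (∇₀-separated X)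

    ∇₀-reflects : ReflectsOntoExactly (λ X → IsSheaf X × UIP X) (∇₀ S) (ι S)
    ∇₀-reflects = record
      { reflected = ∇₀-sheaf∧UIP
      ; universal = λ { X Y (sheaf , uip) →
          ∘ι-isEquiv sheaf (sheaf∧UIP⇒separated sheaf uip) }
      ; exactly   = λ X → mk⇔
          -- Univalence identifies `X` with `∇₀ S X`, whose properties transport back.
          (λ e → subst (λ Z → IsSheaf Z × UIP Z) (sym (ua (ι S X , e))) (∇₀-sheaf∧UIP X))
          (λ { (sheaf , uip) → ι-isEquiv sheaf (sheaf∧UIP⇒separated sheaf uip) })
      }

mainTheorem2 : Univalence → (S : StableClassifier) →
    ((X : Set) → IsSheaf X → UIP X ⇔ IsSeparated X)
    × ReflectsOntoExactly (λ X → IsSheaf X × UIP X) (∇₀ S) (ι S)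
mainTheorem2 univalence S =
    (λ X sheaf → mk⇔ (sheaf∧UIP⇒separated univalence sheaf) separated⇒UIP)
  , ∇₀-reflects univalence S
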